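{- Let $G$ be a connected graph with $n>1$ vertices of pathwidth $\mathrm{pw}$. Then, for all $s\in V(G)$, it holds that \[ b(G,s)\ \ge\ \sqrt{\frac{(n/(\mathrm{pw}+1))^{1/(\mathrm{pw}+1)}}{2\,\mathrm{pw}}}. \]
   Context: All graphs are finite, undirected and loopless. Telephone model: at the start exactly one vertex, the source $s$, is informed; in each round every informed vertex may send the message to at most one of its uninformed neighbors, which is informed by the end of that round. For a connected graph $G$ and $s\in V(G)$, $b(G,s)$ is the minimum number of rounds needed to inform all vertices of $G$ starting from $s$. The width of a path decomposition is the maximum bag size minus one, and the pathwidth is the minimum width of a path decomposition. -}

module Defs where

open import Level using (0ℓ)
open import Data.Fin using (Fin) renaming (_≤_ to _≤ᶠ_)
open import Data.Fin.Subset using (Subset; _∈_; _∉_; ⁅_⁆; ∣_∣)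
open import Data.Integer using (+_)
open import Data.Maybe using (Maybe; just)
open import Data.Nat using (ℕ; zero; suc; _≤_; _∸_; _⊔_; NonZero)
open import Data.Product using (_×_; ∃)
open import Data.Rational using (ℚ; 0ℚ; +-*-rawSemiring)
  renaming (_<_ to _<ℚ_; _*_ to _*ℚ_; _/_ to _/ℚ_)
open import Data.Sum using (_⊎_)
open import Data.Vec.Functional using (Vector; foldr; map)
open import Function using (_⇔_)
open import Relation.Binary using (Rel; Symmetric; Irreflexive; Decidable)
open import Relation.Binary.Construct.Closure.ReflexiveTransitive using (Star)
open import Relation.Binary.PropositionalEquality using (_≡_)

open import Algebra.Definitions.RawSemiring +-*-rawSemiring
  using () renaming (_^_ to _^ℚ_)

record IsMinimum (P : ℕ → Set) (m : ℕ) : Set where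
  field
    attained : P m
    minimal  : ∀ k → P k → m ≤ k

record Graph (n : ℕ) : Set₁ where
  field
    Adj     : Rel (Fin n) 0ℓ
    adj?    : Decidable Adj
    adj-sym : Symmetric Adj
    no-loop : Irreflexive _≡_ Adj

open Graph public

Connected : ∀ {n} → Graph n → Set
Connected G = ∀ u v → Star (Adj G) u v

record PathDecomposition {n : ℕ} (G : Graph n) : Set where
  field
    length        : ℕ
    bag           : Vector (Subset n) length
    covers-vertex : ∀ v → ∃ λ i → v ∈ bag i
    covers-edge   : ∀ {u v} → Adj G u v → ∃ λ i → u ∈ bag i × v ∈ bag i
    interval      : ∀ {i j k} → i ≤ᶠ j → j ≤ᶠ k →
                    ∀ {v} → v ∈ bag i → v ∈ bag k → v ∈ bag j

  maxBagSize : ℕ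
  maxBagSize = foldr _⊔_ 0 (map ∣_∣ bag)

  -- When n ≥ 1 some bag is nonempty, so the subtraction is not truncated.
  width : ℕ
  width = maxBagSize ∸ 1

IsPathwidth : ∀ {n} → Graph n → ℕ → Set
IsPathwidth G =
  IsMinimum λ w → ∃ λ (D : PathDecomposition G) → PathDecomposition.width D ≡ w

-- A round takes the set A of informed vertices to the set B.  Each vertex u
-- places at most one call, namely to v when call u ≡ just v.
record Round {n : ℕ} (G : Graph n) (A B : Subset n) : Set where
  field
    call     : Fin n → Maybe (Fin n)
    valid    : ∀ {u v} → call u ≡ just v → u ∈ A × v ∉ A × Adj G u v
    informed : ∀ v → v ∈ B ⇔ (v ∈ A ⊎ ∃ λ u → call u ≡ just v)

data Informs {n : ℕ} (G : Graph n) : Subset n → ℕ → Set where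
  done : ∀ {A} → (∀ v → v ∈ A) → Informs G A zero
  step : ∀ {A B t} → Round G A B → Informs G B t → Informs G A (suc t)

-- IsBroadcastTime G s b says that b(G,s) = b.
IsBroadcastTime : ∀ {n} → Graph n → Fin n → ℕ → Set
IsBroadcastTime G s = IsMinimum (Informs G ⁅ s ⁆)

-- A real number x is represented by its open lower Dedekind cut
-- { q ∈ ℚ ∣ q < x }; the order of the reals is then inclusion of cuts.
Cut : Set₁
Cut = ℚ → Set

infix  4 _≤ᶜ_
infixl 7 _÷_

_≤ᶜ_ : Cut → Cut → Set
x ≤ᶜ y = ∀ q → x q → y q

⟦_⟧ : ℚ → Cut
⟦ p ⟧ q = q <ℚ p

-- For c > 0: q < x / c iff q c < x.  For c = 0 and x > 0 this is the cut of +∞,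
-- so an upper bound on x ÷ c also asserts c ≠ 0.
_÷_ : Cut → ℕ → Cut
(x ÷ c) q = x (q *ℚ (+ c /ℚ 1))

-- The nonnegative k-th root of x ≥ 0: for q ≥ 0, q < x^(1/k) iff q^k < x.
root : (k : ℕ) .{{_ : NonZero k}} → Cut → Cut
root k x q = q <ℚ 0ℚ ⊎ x (q ^ℚ k)

√_ : Cut → Cut
√ x = root 2 x

{-# OPTIONS --safe #-}
-- The calls of a broadcast form a spanning tree in which a vertex is determined
-- by its parent and the number of rounds left once it is informed, its level.
-- Let u and v lie in the first and the last bag that meets the subtree below c.
-- The ancestors of u and v inside this subtree connect these two bags, so they
-- hit every bag meeting the subtree, and each subtree left after removing them
-- has bags smaller by one.  Levels increase strictly towards the root, so u and
-- v have at most b ancestors of positive level each, and each of these has at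
-- most b children: at most 2b² subtrees are left.  By induction on the size k
-- of the bags, n + 1 ≤ 2 (2b²)ᵏ.
module Submission where

open import Defs
open import Data.Fin using (Fin; zero; suc; toℕ; fromℕ<) renaming (_≤_ to _≤ᶠ_)
open import Data.Fin.Properties using (any?; toℕ-fromℕ<; injective⇒≤)
  renaming (_≟_ to _≟ᶠ_; ≤-total to ≤ᶠ-total; ≤-trans to ≤ᶠ-trans)
open import Data.Fin.Subset using (Subset; ⁅_⁆; ∣_∣)
  renaming (_∈_ to _∈ˢ_; _∉_ to _∉ˢ_)
open import Data.Fin.Subset.Properties
  using (_∈?_; x∈⁅y⁆⇒x≡y; x∈p⇒∣p-x∣<∣p∣; x∈p∧x≢y⇒x∈p-y)
open import Data.Integer using (+_; +≤+)
import Data.Integer as ℤ using (_*_; _≤_)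
import Data.Integer.Properties as ℤ
open import Data.List using ([]; _∷_; _++_; length)
open import Data.List.Membership.Propositional using (_∈_)
open import Data.List.Membership.Propositional.Properties using (∈-++⁺ˡ; ∈-++⁺ʳ)
open import Data.List.Membership.Setoid.Properties using (index-injective)
open import Data.List.Properties using (length-++)
open import Data.List.Relation.Unary.All as All using (All; []; _∷_)
open import Data.List.Relation.Unary.AllPairs using ([]; _∷_)
open import Data.List.Relation.Unary.Any using (here; there)
open import Data.List.Relation.Unary.Unique.Propositional using (Unique)
open import Data.Maybe using (Maybe; just; nothing)
open import Data.Maybe.Properties using (just-injective; ≡-dec)
open import Data.Nat using (ℕ; zero; suc; z≤n; s≤s; s≤s⁻¹; NonZero; >-nonZero;
  _+_; _*_; _^_; pred; _∸_; _⊔_; _≤_; _<_; _≟_)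
open import Data.Nat.Induction using (<-wellFounded)
open import Data.Nat.Properties
open import Data.Nat.Solver using (module +-*-Solver)
open import Data.Product using (_×_; _,_; proj₁; proj₂; ∃; ∃-syntax; -,_; map₂)
open import Data.Rational using (ℚ; _/_; 0ℚ; toℚᵘ; nonNegative; +-*-rawSemiring)
  renaming (_≤_ to _≤ℚ_; _*_ to _*ℚ_)
open import Data.Rational.Properties as ℚ using ()
open import Data.Rational.Unnormalised using (mkℚᵘ; *≡*; *≤*)
import Data.Rational.Unnormalised as ℚᵘ using (_*_)
import Data.Rational.Unnormalised.Properties as ℚᵘ
open import Data.Sum using (_⊎_; inj₁; inj₂; [_,_]′)
open import Data.Vec.Functional using (Vector; foldr)
open import Function using (_∘_; _on_; flip; id; Equivalence)
import Induction.WellFounded as WF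
open import Level using (0ℓ)
open import Relation.Binary using (Rel; Total; Transitive; _⇒_)
open import Relation.Binary.Construct.Closure.ReflexiveTransitive
  using (Star; ε; _◅_; _◅◅_)
import Relation.Binary.Construct.On as On
open import Relation.Binary.PropositionalEquality
  using (_≡_; _≢_; refl; sym; trans; cong; subst; subst₂; setoid)
open import Relation.Nullary using (¬_; Dec; yes; no; contradiction)
open import Relation.Nullary.Decidable using (_×-dec_)
open import Relation.Unary using (Pred; Decidable)

open import Algebra.Definitions.RawSemiring +-*-rawSemiring
  using () renaming (_^_ to _^ℚ_)

-- Extremal indices and counting by lists.

extremum : ∀ {m} {_⊑_ : Rel (Fin m) 0ℓ} → Total _⊑_ → Transitive _⊑_ →
           {P : Pred (Fin m) 0ℓ} → Decidable P → ∃ P →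
           ∃[ i ] P i × (∀ j → P j → i ⊑ j)
extremum {suc m} {_⊑_} total transitive {P} P? (i₀ , p₀) with any? (P? ∘ suc)
... | no none = zero , Pzero i₀ p₀ , least
  where
  Pzero : ∀ i → P i → P zero
  Pzero zero    p = p
  Pzero (suc i) p = contradiction (i , p) none
  least : ∀ j → P j → zero ⊑ j
  -- Reflexivity is extracted from totality at equal arguments.
  least zero    _ = [ id , id ]′ (total zero zero)
  least (suc j) p = contradiction (j , p) none
... | yes some
  with extremum {_⊑_ = _⊑_ on suc} (λ i j → total (suc i) (suc j)) transitive (P? ∘ suc) some
     | P? zero
...   | i , pᵢ , least | no ¬p = suc i , pᵢ , λ where
  zero    p → contradiction p ¬p
  (suc j) p → least j p
...   | i , pᵢ , least | yes p with total zero (suc i)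
...     | inj₁ 0⊑i = zero , p , λ where
  zero    _ → [ id , id ]′ (total zero zero)
  (suc j) q → transitive 0⊑i (least j q)
...     | inj₂ i⊑0 = suc i , pᵢ , λ where
  zero    _ → i⊑0
  (suc j) q → least j q

-- Sizes are bounded through lists of distinct elements, so that exhibiting one further element is a
-- single `∷`.
AtMost : ∀ {n} → ℕ → Pred (Fin n) 0ℓ → Set
AtMost k P = ∀ {xs} → Unique xs → All P xs → length xs ≤ k

subset-atMost : ∀ {n} (p : Subset n) → AtMost ∣ p ∣ (_∈ˢ p)
subset-atMost p []             []           = z≤n
subset-atMost p (x∉xs ∷ unique) (x∈p ∷ xs⊆p) =
  ≤-<-trans (subset-atMost _ unique (All.zipWith (λ (y∈p , x≢y) → x∈p∧x≢y⇒x∈p-y y∈p (x≢y ∘ sym))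
                                                 (xs⊆p , x∉xs)))
            (x∈p⇒∣p-x∣<∣p∣ x∈p)

-- Repetitions are allowed in the covering list, so unions are covered by concatenation.
Covered : ∀ {n} → Pred (Fin n) 0ℓ → ℕ → Set
Covered P m = ∃[ xs ] length xs ≤ m × (∀ {x} → P x → x ∈ xs)

⋃-covered : ∀ {n} m {k} {Q : Fin m → Pred (Fin n) 0ℓ} →
            (∀ j → Covered (Q j) k) → Covered (λ x → ∃[ j ] Q j x) (m * k)
⋃-covered zero    cover = [] , z≤n , λ ()
⋃-covered (suc m) cover with cover zero | ⋃-covered m (cover ∘ suc)
... | xs , xs≤ , ⊆xs | ys , ys≤ , ⊆ys =
  xs ++ ys ,
  ≤-trans (≤-reflexive (length-++ xs)) (+-mono-≤ xs≤ ys≤) ,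
  λ where
    (zero  , q) → ∈-++⁺ˡ (⊆xs q)
    (suc j , q) → ∈-++⁺ʳ xs (⊆ys (j , q))

covered-all⇒≤ : ∀ {n m} {P : Pred (Fin n) 0ℓ} → Covered P m → (∀ x → P x) → n ≤ m
covered-all⇒≤ (xs , xs≤ , ⊆xs) all =
  ≤-trans (injective⇒≤ (λ {x y} → index-injective (setoid _) (⊆xs (all x)) (⊆xs (all y)))) xs≤

-- Path decompositions.

module _ {n} {G : Graph n} (D : PathDecomposition G) where
  open PathDecomposition D hiding (length)
  private len = PathDecomposition.length D

  -- Walk along the path, keeping the current vertex in a bag before `j`. The bag of the next edge
  -- either lies at or past `j`, and convexity puts the current vertex into bag `j`, or it lies
  -- before `j` and replaces bag `i`. The order is a parameter so that the walk can also run from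
  -- right to left.
  crossing : {_⊑_ : Rel (Fin len) 0ℓ} → Total _⊑_ →
             (∀ {i j k} → i ⊑ j → j ⊑ k → ∀ {v} → v ∈ˢ bag i → v ∈ˢ bag k → v ∈ˢ bag j) →
             {R : Rel (Fin n) 0ℓ} → R ⇒ Adj G →
             ∀ {i j k x y} → i ⊑ j → j ⊑ k → x ∈ˢ bag i → y ∈ˢ bag k → Star R x y →
             ∃[ p ] Star R x p × Star R p y × p ∈ˢ bag j
  crossing total convex R⇒Adj i⊑j j⊑k x∈i x∈k ε = -, ε , ε , convex i⊑j j⊑k x∈i x∈k
  crossing total convex R⇒Adj {j = j} i⊑j j⊑k x∈i y∈k (e ◅ es) with covers-edge (R⇒Adj e)
  ... | m , x∈m , z∈m with total j m
  ...   | inj₁ j⊑m = -, ε , e ◅ es , convex i⊑j j⊑m x∈i x∈m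
  ...   | inj₂ m⊑j with crossing total convex R⇒Adj m⊑j j⊑k z∈m y∈k es
  ...     | p , z⇝p , p⇝y , p∈j = p , e ◅ z⇝p , p⇝y , p∈j

  ∣bag∣≤1+width : ∀ i → ∣ bag i ∣ ≤ suc width
  ∣bag∣≤1+width i = ≤-trans (≤max (∣_∣ ∘ bag) i) (m≤n+m∸n maxBagSize 1)
    where
    ≤max : ∀ {m} (f : Vector ℕ m) i → f i ≤ foldr _⊔_ 0 f
    ≤max f zero    = m≤m⊔n _ _
    ≤max f (suc i) = ≤-trans (≤max (f ∘ suc) i) (m≤n⊔m (f zero) _)

  edge⇒width≥1 : ∀ {x y} → Adj G x y → 1 ≤ width
  edge⇒width≥1 {x} {y} e with covers-edge e
  ... | i , x∈i , y∈i =
    s≤s⁻¹ (≤-trans (subset-atMost (bag i) ((x≢y ∷ []) ∷ [] ∷ []) (x∈i ∷ y∈i ∷ [])) (∣bag∣≤1+width i))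
    where
    x≢y : x ≢ y
    x≢y x≡y = no-loop G x≡y e

-- The call forest of a broadcast.

-- The level of a vertex is the number of rounds left once it is informed.
record CallForest {n : ℕ} (G : Graph n) (A : Subset n) (t : ℕ) : Set where
  field
    level      : Fin n → ℕ
    parent     : Fin n → Maybe (Fin n)
    level-root : ∀ {x} → x ∈ˢ A → level x ≡ t
    called     : ∀ {x} → x ∉ˢ A → ∃[ p ] parent x ≡ just p
    level≤     : ∀ x → level x ≤ t
    edge       : ∀ {x p} → parent x ≡ just p → Adj G x p
    ascends    : ∀ {x p} → parent x ≡ just p → level x < level p
    determined : ∀ {x y p} → parent x ≡ just p → parent y ≡ just p → level x ≡ level y → x ≡ y

extend : ∀ {n t} {G : Graph n} {A B : Subset n} →
         Round G A B → CallForest G B t → CallForest G A (suc t)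
extend {n} {t} {G} {A} {B} round forest = record
  { level      = level′ ∘ origin
  ; parent     = parent′ ∘ origin
  ; level-root = λ {x} → level-root′ (origin x)
  ; called     = λ {x} → called′ (origin x)
  ; level≤     = level≤′ ∘ origin
  ; edge       = λ {x} → edge′ (origin x)
  ; ascends    = λ {x p} → ascends′ (origin x) (origin p)
  ; determined = λ {x y} → determined′ (origin x) (origin y)
  }
  where
  open Round round
  open CallForest forest

  -- Several vertices may call the same `x` in one round; `new` fixes one caller, which becomes the
  -- parent.
  data Origin (x : Fin n) : Set where
    old   : x ∈ˢ A → Origin x
    new   : x ∉ˢ A → x ∈ˢ B → ∀ {u} → call u ≡ just x → Origin x
    later : x ∉ˢ A → x ∉ˢ B → Origin x

  origin : ∀ x → Origin x
  origin x with x ∈? A | x ∈? B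
  ... | yes x∈A | _       = old x∈A
  ... | no  x∉A | no  x∉B = later x∉A x∉B
  ... | no  x∉A | yes x∈B with Equivalence.to (informed x) x∈B
  ...   | inj₁ x∈A       = contradiction x∈A x∉A
  ...   | inj₂ (_ , u↦x) = new x∉A x∈B u↦x

  level′ : ∀ {x} → Origin x → ℕ
  level′     (old _)     = suc t
  level′     (new _ _ _) = t
  level′ {x} (later _ _) = level x

  parent′ : ∀ {x} → Origin x → Maybe (Fin n)
  parent′     (old _)         = nothing
  parent′     (new _ _ {u} _) = just u
  parent′ {x} (later _ _)     = parent x

  level-root′ : ∀ {x} (o : Origin x) → x ∈ˢ A → level′ o ≡ suc t
  level-root′ (old _)       x∈A = refl
  level-root′ (new x∉A _ _) x∈A = contradiction x∈A x∉A
  level-root′ (later x∉A _) x∈A = contradiction x∈A x∉A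

  called′ : ∀ {x} (o : Origin x) → x ∉ˢ A → ∃[ p ] parent′ o ≡ just p
  called′ (old x∈A)     x∉A = contradiction x∈A x∉A
  called′ (new _ _ _)   _   = -, refl
  called′ (later _ x∉B) _   = called x∉B

  level≤′ : ∀ {x} (o : Origin x) → level′ o ≤ suc t
  level≤′ (old _)     = ≤-refl
  level≤′ (new _ _ _) = n≤1+n t
  level≤′ (later _ _) = m≤n⇒m≤1+n (level≤ _)

  edge′ : ∀ {x p} (o : Origin x) → parent′ o ≡ just p → Adj G x p
  edge′ (new _ _ u↦x) refl = adj-sym G (proj₂ (proj₂ (valid u↦x)))
  edge′ (later _ _)   eq   = edge eq

  -- Prepending a round lowers no level, so an edge kept from `forest` still ascends when its upper
  -- end changes level.
  level≤level′ : ∀ {x} (o : Origin x) → level x ≤ level′ o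
  level≤level′ (old _)     = m≤n⇒m≤1+n (level≤ _)
  level≤level′ (new _ _ _) = level≤ _
  level≤level′ (later _ _) = ≤-refl

  ascends′ : ∀ {x p} (o : Origin x) (o′ : Origin p) → parent′ o ≡ just p → level′ o < level′ o′
  -- A caller lies in `A` and has level `suc t`, one above the vertex it calls.
  ascends′ (new _ _ u↦x) (old _)       refl = ≤-refl
  ascends′ (new _ _ u↦x) (new p∉A _ _) refl = contradiction (proj₁ (valid u↦x)) p∉A
  ascends′ (new _ _ u↦x) (later p∉A _) refl = contradiction (proj₁ (valid u↦x)) p∉A
  ascends′ (later _ _)   o′            eq   = <-≤-trans (ascends eq) (level≤level′ o′)

  -- Separates the children kept from `forest` from the new ones, whose level is `t`.
  level≢t : ∀ {x p} → parent x ≡ just p → level x ≢ t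
  level≢t eq = <⇒≢ (<-≤-trans (ascends eq) (level≤ _))

  determined′ : ∀ {x y p} (o : Origin x) (o′ : Origin y) →
                parent′ o ≡ just p → parent′ o′ ≡ just p → level′ o ≡ level′ o′ → x ≡ y
  -- A vertex places one call per round, so it gains at most one new child.
  determined′ (new _ _ p↦x) (new _ _ p↦y) refl refl _ = just-injective (trans (sym p↦x) p↦y)
  determined′ (new _ _ _)   (later _ _)   _    eq   l = contradiction (sym l) (level≢t eq)
  determined′ (later _ _)   (new _ _ _)   eq   _    l = contradiction l (level≢t eq)
  determined′ (later _ _)   (later _ _)   eq   eq′  l = determined eq eq′ l

informs⇒forest : ∀ {n t} {G : Graph n} {A : Subset n} → Informs G A t → CallForest G A t
informs⇒forest (done all) = record
  { level      = λ _ → 0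
  ; parent     = λ _ → nothing
  ; level-root = λ _ → refl
  ; called     = λ x∉A → contradiction (all _) x∉A
  ; level≤     = λ _ → z≤n
  ; edge       = λ ()
  ; ascends    = λ ()
  ; determined = λ ()
  }
informs⇒forest (step round rest) = extend round (informs⇒forest rest)

-- The numerical recursion.

capacity : ℕ → ℕ → ℕ
capacity b zero    = 1
-- `suc` counts the top of the subtree, 2 the ends of its spine, and the two factors `b` the levels
-- of a child and of its parent.
capacity b (suc k) = suc (2 * (b * (b * capacity b k)))

capacity≥1 : ∀ b k → 1 ≤ capacity b k
capacity≥1 b zero    = ≤-refl
capacity≥1 b (suc k) = s≤s z≤n

-- The strict inequality absorbs the suc in capacity, because 2 ≤ 2b².
capacity< : ∀ b k → 1 ≤ b → capacity b k < 2 * (2 * (b * b)) ^ k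
capacity< b zero    1≤b = ≤-refl
capacity< b (suc k) 1≤b = begin
  2 + 2 * (b * (b * c))              ≤⟨ +-monoˡ-≤ _ (*-monoʳ-≤ 2 (*-mono-≤ 1≤b 1≤b)) ⟩
  2 * (b * b) + 2 * (b * (b * c))    ≡⟨ solve 2 (λ b c → con 2 :* (b :* b) :+ con 2 :* (b :* (b :* c))
                                                     := (con 2 :* (b :* b)) :* (con 1 :+ c)) refl b c ⟩
  x * suc c                          ≤⟨ *-monoʳ-≤ x (capacity< b k 1≤b) ⟩
  x * (2 * x ^ k)                    ≡⟨ solve 2 (λ x y → x :* (con 2 :* y) := con 2 :* (x :* y)) refl x (x ^ k) ⟩
  2 * (x * x ^ k)                    ∎
  where
  open ≤-Reasoning
  open +-*-Solver
  c = capacity b k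
  x = 2 * (b * b)

-- Ancestors and spines in the call forest.

module Forest {n b} {G : Graph n} {A : Subset n} (forest : CallForest G A b) where
  open CallForest forest

  Parent : Rel (Fin n) 0ℓ
  Parent x p = parent x ≡ just p

  infix 4 _⇝_ _⇝?_

  _⇝_ : Rel (Fin n) 0ℓ
  _⇝_ = Star Parent

  -- Levels rise towards the parent and are bounded by `b`, so `b ∸ level x` decreases.
  parent-rec : (P : Pred (Fin n) 0ℓ) → (∀ x → (∀ {p} → Parent x p → P p) → P x) → ∀ x → P x
  parent-rec P ih = WF.All.wfRec (On.wellFounded (λ x → b ∸ level x) <-wellFounded) 0ℓ P
    (λ x rec → ih x (λ x→p → rec (∸-monoʳ-< (ascends x→p) (level≤ _))))

  _⇝?_ : ∀ x y → Dec (x ⇝ y)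
  x ⇝? y = parent-rec (λ x → Dec (x ⇝ y)) body x
    where
    body : ∀ x → (∀ {p} → Parent x p → Dec (p ⇝ y)) → Dec (x ⇝ y)
    body x rec with x ≟ᶠ y | parent x in eq
    ... | yes refl | _       = yes ε
    ... | no  x≢y  | nothing = no λ where
      ε        → x≢y refl
      (eq′ ◅ _) → contradiction (trans (sym eq) eq′) λ ()
    ... | no  x≢y  | just p with rec refl
    ...   | yes p⇝y = yes (eq ◅ p⇝y)
    ...   | no ¬p⇝y = no λ where
      ε          → x≢y refl
      (eq′ ◅ p⇝y) → ¬p⇝y (subst (_⇝ y) (just-injective (trans (sym eq′) eq)) p⇝y)

  level-mono : ∀ {x y} → x ⇝ y → level x ≤ level y
  level-mono ε          = ≤-refl
  level-mono (e ◅ p⇝y) = ≤-trans (<⇒≤ (ascends e)) (level-mono p⇝y)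

  -- The ancestors of a vertex form a chain along which levels increase strictly.
  ancestor-unique : ∀ {x p q} → x ⇝ p → x ⇝ q → level p ≡ level q → p ≡ q
  ancestor-unique ε        ε         _  = refl
  ancestor-unique ε        (e ◅ es)  eq = contradiction eq (<⇒≢ (<-≤-trans (ascends e) (level-mono es)))
  ancestor-unique (e ◅ es) ε         eq = contradiction (sym eq) (<⇒≢ (<-≤-trans (ascends e) (level-mono es)))
  ancestor-unique (e ◅ es) (f ◅ fs)  eq with just-injective (trans (sym e) f)
  ... | refl = ancestor-unique es fs eq

  module _ (D : PathDecomposition G) where
    open PathDecomposition D hiding (length)

    Thin : ℕ → Fin n → Set
    Thin k c = ∀ i → AtMost k (λ x → x ∈ˢ bag i × x ⇝ c)

    -- The two ends of the spine of c are descendants of c in the first and in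
    -- the last bag that meets the subtree of c.
    module Spine {k c} (thin : Thin (suc k) c) where
      Meets : Pred (Fin (PathDecomposition.length D)) 0ℓ
      Meets i = ∃[ x ] x ∈ˢ bag i × x ⇝ c

      meets? : Decidable Meets
      meets? i = any? (λ x → (x ∈? bag i) ×-dec (x ⇝? c))

      c-meets : ∃ Meets
      c-meets = map₂ (λ c∈i → c , c∈i , ε) (covers-vertex c)

      first : ∃[ i ] Meets i × (∀ j → Meets j → i ≤ᶠ j)
      first = extremum ≤ᶠ-total ≤ᶠ-trans meets? c-meets

      last : ∃[ i ] Meets i × (∀ j → Meets j → j ≤ᶠ i)
      last = extremum {_⊑_ = flip _≤ᶠ_} (flip ≤ᶠ-total) (flip ≤ᶠ-trans) meets? c-meets

      end : Fin 2 → Fin n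
      end zero       = proj₁ (proj₁ (proj₂ first))
      end (suc zero) = proj₁ (proj₁ (proj₂ last))

      end⇝c : ∀ a → end a ⇝ c
      end⇝c zero       = proj₂ (proj₂ (proj₁ (proj₂ first)))
      end⇝c (suc zero) = proj₂ (proj₂ (proj₁ (proj₂ last)))

      OnSpine : Pred (Fin n) 0ℓ
      OnSpine p = ∃[ a ] end a ⇝ p

      onSpine? : Decidable OnSpine
      onSpine? p = any? (λ a → end a ⇝? p)

      -- A bag containing `c` splits the range: left of it, the path from the first end up to `c`
      -- crosses bag `j`; right of it, the path from the last end does.
      spine-meets : ∀ {j} → Meets j → ∃[ p ] p ∈ˢ bag j × p ⇝ c × OnSpine p
      spine-meets {j} m with covers-vertex c
      ... | i , c∈i with ≤ᶠ-total j i
      ...   | inj₁ j≤i =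
        let _ , (_ , u∈ , u⇝c) , least = first
            p , u⇝p , p⇝c , p∈j = crossing D ≤ᶠ-total interval edge (least j m) j≤i u∈ c∈i u⇝c
        in p , p∈j , p⇝c , zero , u⇝p
      ...   | inj₂ i≤j =
        let _ , (_ , v∈ , v⇝c) , greatest = last
            -- This path starts in the last bag, so the order is reversed.
            p , v⇝p , p⇝c , p∈j = crossing D (flip ≤ᶠ-total)
              (λ j≤i k≤j v∈i v∈k → interval k≤j j≤i v∈k v∈i) edge (greatest j m) i≤j v∈ c∈i v⇝c
        in p , p∈j , p⇝c , suc zero , v⇝p

      -- The bag contains a spine vertex `p` below `c`. It is not below `d`, since otherwise `d`
      -- would be on the spine; hence `p` can be prepended to any list of distinct descendants of
      -- `d` in this bag.
      thin-off-spine : ∀ {d} → d ⇝ c → ¬ OnSpine d → Thin k d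
      thin-off-spine d⇝c off i []             []                 = z≤n
      thin-off-spine d⇝c off i unique@(_ ∷ _) all@((x∈i , x⇝d) ∷ _)
        with spine-meets (-, x∈i , x⇝d ◅◅ d⇝c)
      ... | p , p∈i , p⇝c , a , a⇝p = s≤s⁻¹ (thin i
        (All.map (λ (_ , y⇝d) p≡y → off (a , subst (end a ⇝_) p≡y a⇝p ◅◅ y⇝d)) all ∷ unique)
        ((p∈i , p⇝c) ∷ All.map (map₂ (_◅◅ d⇝c)) all))

      -- The parent's level is positive and at most `b`, hence `suc (toℕ i)`; the child's level is
      -- below `b`, hence `toℕ j`.
      Child : Fin 2 → Fin b → Fin b → Pred (Fin n) 0ℓ
      Child a i j d = d ⇝ c × level d ≡ toℕ j × ∃[ p ] Parent d p × end a ⇝ p × level p ≡ suc (toℕ i)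

      child? : ∀ a i j → Decidable (Child a i j)
      child? a i j d = (d ⇝? c) ×-dec (level d ≟ toℕ j) ×-dec any? λ p →
        ≡-dec _≟ᶠ_ (parent d) (just p) ×-dec (end a ⇝? p) ×-dec (level p ≟ suc (toℕ i))

      -- The level fixes the parent among the ancestors of `end a`; the parent and its own level
      -- then fix the child.
      child-unique : ∀ a {i j d e} → Child a i j d → Child a i j e → d ≡ e
      child-unique a (_ , d≡j , p , d→p , a⇝p , p≡i) (_ , e≡j , q , e→q , a⇝q , q≡i)
        with ancestor-unique a⇝p a⇝q (trans p≡i (sym q≡i))
      ... | refl = determined d→p e→q (trans d≡j (sym e≡j))

      -- A child on the spine stands for itself only: the vertices below it hang
      -- off the spine further down.
      Branch : Fin 2 → Fin b → Fin b → Pred (Fin n) 0ℓ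
      Branch a i j x = ∃[ d ] Child a i j d × x ⇝ d × (x ≡ d ⊎ ¬ OnSpine d)

      -- Climb from `x` until the parent is on the spine. As `c` is on the spine, this happens
      -- unless `x` is `c`.
      branch : ∀ {x} → x ⇝ c → x ≡ c ⊎ (∃[ a ] ∃[ i ] ∃[ j ] Branch a i j x)
      branch ε = inj₁ refl
      branch {x} (_◅_ {j = p} x→p p⇝c) with onSpine? p
      ... | yes (a , a⇝p) =
        inj₂ (a , fromℕ< i<b , fromℕ< j<b , x ,
              (x→p ◅ p⇝c , sym (toℕ-fromℕ< j<b) , p , x→p , a⇝p , p≡i) , ε , inj₁ refl)
        where
        j<b : level x < b
        j<b = <-≤-trans (ascends x→p) (level≤ p)
        instance
          level-p≢0 : NonZero (level p)
          level-p≢0 = >-nonZero (≤-<-trans z≤n (ascends x→p))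
        i<b : pred (level p) < b
        i<b = ≤-trans (≤-reflexive (suc-pred (level p))) (level≤ p)
        p≡i : level p ≡ suc (toℕ (fromℕ< i<b))
        p≡i = sym (trans (cong suc (toℕ-fromℕ< i<b)) (suc-pred (level p)))
      ... | no off with branch p⇝c
      ...   | inj₁ refl = contradiction (zero , end⇝c zero) off
      ...   | inj₂ (a , i , j , d , child , p⇝d , p≡d⊎off) =
        inj₂ (a , i , j , d , child , x→p ◅ p⇝d ,
              -- The child `d` reached from `p` is either `p` itself, which is off the spine, or off
              -- the spine by recursion.
              inj₂ ([ (λ p≡d → subst (¬_ ∘ OnSpine) p≡d off) , id ]′ p≡d⊎off))

    descendants-covered : ∀ k {c} → Thin k c → Covered (_⇝ c) (capacity b k)
    -- This case cannot occur, because `c` itself lies in some bag.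
    descendants-covered zero    {c} thin =
      let i , c∈i = covers-vertex c
      in contradiction (thin i ([] ∷ []) ((c∈i , ε) ∷ [])) λ ()
    descendants-covered (suc k) {c} thin =
      let xs , xs≤ , ⊆xs = ⋃-covered 2 λ a → ⋃-covered b λ i → ⋃-covered b λ j → branch-covered a i j
      in c ∷ xs , s≤s xs≤ , λ x⇝c → [ here , there ∘ ⊆xs ]′ (branch x⇝c)
      where
      open Spine thin

      branch-covered : ∀ a i j → Covered (Branch a i j) (capacity b k)
      branch-covered a i j with any? (child? a i j)
      ... | no none = [] , z≤n , λ (d , child , _) → contradiction (d , child) none
      ... | yes (d , child) with onSpine? d
      -- The branch is `d` alone; `capacity≥1` makes room for it even when `k` is 0.
      ...   | yes on = d ∷ [] , capacity≥1 b k , λ where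
        (e , child′ , _ , inj₁ refl) → here (child-unique a child′ child)
        (e , child′ , _ , inj₂ off)  → contradiction (subst OnSpine (child-unique a child child′) on) off
      ...   | no off =
        let xs , xs≤ , ⊆xs = descendants-covered k (thin-off-spine (proj₁ child) off)
        in xs , xs≤ , λ (e , child′ , x⇝e , _) → ⊆xs (subst (_ ⇝_) (child-unique a child′ child) x⇝e)

-- The bound on the number of vertices.

module _ {n b} {G : Graph n} {s : Fin n} (forest : CallForest G ⁅ s ⁆ b) where
  open CallForest forest
  open Forest forest

  from-source : ∀ x → x ⇝ s
  from-source = parent-rec (_⇝ s) body
    where
    body : ∀ x → (∀ {p} → Parent x p → p ⇝ s) → x ⇝ s
    body x rec with x ∈? ⁅ s ⁆
    ... | yes x∈s = subst (_⇝ s) (sym (x∈⁅y⁆⇒x≡y s x∈s)) ε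
    ... | no  x∉s = let _ , x→p = called x∉s in x→p ◅ rec x→p

  order≤capacity : (D : PathDecomposition G) → n ≤ capacity b (suc (PathDecomposition.width D))
  order≤capacity D = covered-all⇒≤ (descendants-covered D _ thin) from-source
    where
    thin : Thin D (suc (PathDecomposition.width D)) s
    thin i unique all = ≤-trans (subset-atMost _ unique (All.map proj₁ all)) (∣bag∣≤1+width D i)

  -- Vertices 0 and 1 are not both the source. The edge obtained makes both the width and `b`
  -- positive.
  some-call : 1 < n → ∃[ x ] ∃[ p ] Parent x p
  some-call (s≤s (s≤s _)) with zero ∈? ⁅ s ⁆ | suc zero ∈? ⁅ s ⁆
  ... | no 0∉s  | _      = -, called 0∉s
  ... | yes _   | no 1∉s = -, called 1∉s
  ... | yes 0∈s | yes 1∈s with trans (x∈⁅y⁆⇒x≡y s 0∈s) (sym (x∈⁅y⁆⇒x≡y s 1∈s))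
  ...   | ()

  -- This is the claimed inequality with roots and fractions cleared.
  order-bound : 1 < n → (D : PathDecomposition G) → let w = PathDecomposition.width D in
                n ≤ suc w * (b ^ 2 * (2 * w)) ^ suc w
  order-bound 1<n D with some-call 1<n
  ... | x , p , x→p = begin
    n                                     ≤⟨ order≤capacity D ⟩
    capacity b (suc w)                    ≤⟨ <⇒≤ (capacity< b (suc w) 1≤b) ⟩
    -- As `1 ≤ w`, the factor `suc w` absorbs the leading 2 and `2 * w` the 2 in the base.
    2 * (2 * (b * b)) ^ suc w             ≤⟨ *-mono-≤ (s≤s 1≤w) (^-monoˡ-≤ (suc w) base≤) ⟩
    suc w * (b ^ 2 * (2 * w)) ^ suc w     ∎
    where
    open ≤-Reasoning
    open +-*-Solver
    w = PathDecomposition.width D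
    1≤w : 1 ≤ w
    1≤w = edge⇒width≥1 D (edge x→p)
    1≤b : 1 ≤ b
    1≤b = ≤-trans (≤-trans (s≤s z≤n) (ascends x→p)) (level≤ p)
    base≤ : 2 * (b * b) ≤ b ^ 2 * (2 * w)
    base≤ = begin
      2 * (b * b)       ≡⟨ solve 1 (λ b → con 2 :* (b :* b) := b :^ 2 :* (con 2 :* con 1)) refl b ⟩
      b ^ 2 * (2 * 1)   ≤⟨ *-monoʳ-≤ (b ^ 2) (*-monoʳ-≤ 2 1≤w) ⟩
      b ^ 2 * (2 * w)   ∎

-- Passage to rationals and cuts.

ι : ℕ → ℚ
ι m = + m / 1

-- Checked on unnormalised representatives, where no reduction to lowest terms intervenes.
ι-* : ∀ m n → ι (m * n) ≡ ι m *ℚ ι n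
ι-* m n = ℚ.toℚᵘ-injective (begin-equality
  toℚᵘ (ι (m * n))                       ≃⟨ ℚ.toℚᵘ-fromℚᵘ (mkℚᵘ (+ (m * n)) 0) ⟩
  mkℚᵘ (+ (m * n)) 0                     ≃⟨ *≡* (cong (ℤ._* + 1) (ℤ.pos-* m n)) ⟩
  mkℚᵘ (+ m) 0 ℚᵘ.* mkℚᵘ (+ n) 0         ≃⟨ ℚᵘ.*-cong (ℚ.toℚᵘ-fromℚᵘ (mkℚᵘ (+ m) 0)) (ℚ.toℚᵘ-fromℚᵘ (mkℚᵘ (+ n) 0)) ⟨
  toℚᵘ (ι m) ℚᵘ.* toℚᵘ (ι n)             ≃⟨ ℚ.toℚᵘ-homo-* (ι m) (ι n) ⟨
  toℚᵘ (ι m *ℚ ι n)                      ∎)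
  where open ℚᵘ.≤-Reasoning

ι-^ : ∀ m k → ι (m ^ k) ≡ ι m ^ℚ k
ι-^ m zero    = refl
ι-^ m (suc k) = trans (ι-* m (m ^ k)) (cong (ι m *ℚ_) (ι-^ m k))

ι≥0 : ∀ m → 0ℚ ≤ℚ ι m
ι≥0 m = ℚ.nonNegative⁻¹ (ι m) {{ℚ.normalize-nonNeg m 1}}

/≤ι : ∀ {n d m} → n ≤ suc d * m → + n / suc d ≤ℚ ι m
/≤ι {n} {d} {m} n≤ = ℚ.toℚᵘ-cancel-≤ (begin
  toℚᵘ (+ n / suc d)   ≃⟨ ℚ.toℚᵘ-fromℚᵘ (mkℚᵘ (+ n) d) ⟩
  mkℚᵘ (+ n) d         ≤⟨ *≤* n*1≤m*d ⟩
  mkℚᵘ (+ m) 0         ≃⟨ ℚ.toℚᵘ-fromℚᵘ (mkℚᵘ (+ m) 0) ⟨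
  toℚᵘ (ι m)           ∎)
  where
  open ℚᵘ.≤-Reasoning
  n*1≤m*d : + n ℤ.* + 1 ℤ.≤ + m ℤ.* + suc d
  n*1≤m*d = subst₂ ℤ._≤_ (ℤ.pos-* n 1) (ℤ.pos-* m (suc d))
    (+≤+ (subst₂ _≤_ (sym (*-identityʳ n)) (*-comm (suc d) m) n≤))

*-mono-≤-nonNeg : ∀ {p q r s} → 0ℚ ≤ℚ p → 0ℚ ≤ℚ r → p ≤ℚ q → r ≤ℚ s → p *ℚ r ≤ℚ q *ℚ s
*-mono-≤-nonNeg {p} {q} {r} {s} 0≤p 0≤r p≤q r≤s = ℚ.≤-trans
  (ℚ.*-monoʳ-≤-nonNeg r {{nonNegative 0≤r}} p≤q)
  (ℚ.*-monoˡ-≤-nonNeg q {{nonNegative (ℚ.≤-trans 0≤p p≤q)}} r≤s)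

ι^-mono : ∀ m {q} k → ι m ≤ℚ q → ι (m ^ k) ≤ℚ q ^ℚ k
ι^-mono m     zero    m≤q = ℚ.≤-refl
ι^-mono m {q} (suc k) m≤q = subst (_≤ℚ q ^ℚ suc k) (sym (ι-* m (m ^ k)))
  (*-mono-≤-nonNeg (ι≥0 m) (ι≥0 (m ^ k)) m≤q (ι^-mono m k m≤q))

corollary40 : ∀ (n : ℕ) (G : Graph n) → Connected G → 1 < n →
    ∀ (pw : ℕ) → IsPathwidth G pw →
    ∀ (s : Fin n) (b : ℕ) → IsBroadcastTime G s b →
    √ (root (suc pw) ⟦ + n / suc pw ⟧ ÷ (2 * pw)) ≤ᶜ ⟦ + b / 1 ⟧
corollary40 n G _ 1<n pw isPathwidth s b isBroadcastTime q below with IsMinimum.attained isPathwidth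
-- By contraposition: if `b ≤ q`, then `q` lies outside the cut of the root.
... | D , refl = ℚ.≰⇒> (λ b≤q → ¬below b≤q below)
  where
  module _ (b≤q : ι b ≤ℚ q) where
    base≤ : ι (b ^ 2 * (2 * pw)) ≤ℚ q ^ℚ 2 *ℚ ι (2 * pw)
    base≤ = subst (_≤ℚ q ^ℚ 2 *ℚ ι (2 * pw)) (sym (ι-* (b ^ 2) (2 * pw)))
      (ℚ.*-monoʳ-≤-nonNeg (ι (2 * pw)) {{nonNegative (ι≥0 (2 * pw))}} (ι^-mono b 2 b≤q))

    n/k≤ : + n / suc pw ≤ℚ (q ^ℚ 2 *ℚ ι (2 * pw)) ^ℚ suc pw
    n/k≤ = ℚ.≤-trans
      (/≤ι (order-bound (informs⇒forest (IsMinimum.attained isBroadcastTime)) 1<n D))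
      (ι^-mono (b ^ 2 * (2 * pw)) (suc pw) base≤)

    ¬below : ¬ (√ (root (suc pw) ⟦ + n / suc pw ⟧ ÷ (2 * pw))) q
    -- Unfolding both roots leaves three ways to be in the cut: `q` is negative, `q` squared times
    -- `2 * pw` is negative, or the `suc pw`-th power of the latter is below `n / suc pw`.
    ¬below (inj₁ q<0)        = ℚ.<-irrefl refl (ℚ.<-≤-trans q<0 (ℚ.≤-trans (ι≥0 b) b≤q))
    ¬below (inj₂ (inj₁ r<0)) = ℚ.<-irrefl refl (ℚ.<-≤-trans r<0 (ℚ.≤-trans (ι≥0 (b ^ 2 * (2 * pw))) base≤))
    ¬below (inj₂ (inj₂ r<))  = ℚ.<-irrefl refl (ℚ.<-≤-trans r< n/k≤)
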